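{- Let $\langle P,\leq,{}^\bot,\&\rangle$ be a Sasaki orthoposet, and for $a,b\in P$ let $a\wedge_\& b = (a^\bot \,\&\, b)^\bot \,\&\, b$. Then for all $a,b\in P$, $$ a\,\&\, b = b\wedge_\& (b\wedge_\& a^\bot)^\bot . $$
   Context: A bounded orthoposet $\langle P,\leq,{}^\bot\rangle$ is a partially ordered set with least element $0$ and greatest element $1$ and an orthocomplementation $a\mapsto a^\bot$, i.e. an order-reversing involution ($a\le b\Rightarrow b^\bot\le a^\bot$, $a^{\bot\bot}=a$) such that for every $a$ the meet of $a$ and $a^\bot$ exists and is $0$, and their join exists and is $1$. A Sasaki orthoposet is a tuple $\langle P,\leq,{}^\bot,\&\rangle$ where $\langle P,\leq,{}^\bot\rangle$ is a bounded orthoposet and $\&:P^2\to P$ is a total binary operation such that for all $a,b,c\in P$: (L-Monotony) $a\le b \Rightarrow a\,\&\,c\le b\,\&\,c$; (R-Reduction) $a\,\&\,b\le b$; (Orthomodularity) $a\le b\Rightarrow a=a\,\&\,b$; (Galois) $a\,\&\,b\le c\Rightarrow c^\bot\,\&\,b\le a^\bot$. -}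

module Defs where

open import Level using (Level; suc; _⊔_)
open import Algebra.Core using (Op₁; Op₂)
open import Algebra.Definitions using (Congruent₂; Involutive)
open import Data.Product.Base using (_×_)
open import Function.Base using (flip)
open import Relation.Binary.Core using (Rel)
open import Relation.Binary.Definitions using (Minimum; Maximum; Antitonic₁)
open import Relation.Binary.Bundles using (Poset)

-- The meet of two given elements; the poset need not have all binary meets,
-- so the library's Infimum, which is about a total operation, does not apply.

IsMeet : {a ℓ : Level} {A : Set a} → Rel A ℓ → A → A → A → Set (a ⊔ ℓ)
IsMeet _≤_ x y m = (m ≤ x) × (m ≤ y) × (∀ z → z ≤ x → z ≤ y → z ≤ m)

IsJoin : {a ℓ : Level} {A : Set a} → Rel A ℓ → A → A → A → Set (a ⊔ ℓ)
IsJoin _≤_ = IsMeet (flip _≤_)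

record BoundedOrthoposet (c ℓ₁ ℓ₂ : Level) : Set (suc (c ⊔ ℓ₁ ⊔ ℓ₂)) where
  infix 9 _^⊥
  field
    poset : Poset c ℓ₁ ℓ₂

  open Poset poset public

  field
    0#            : Carrier
    1#            : Carrier
    _^⊥           : Op₁ Carrier
    minimum       : Minimum _≤_ 0#
    maximum       : Maximum _≤_ 1#
    ^⊥-antitone   : Antitonic₁ _≤_ _≤_ _^⊥
    ^⊥-involutive : Involutive _≈_ _^⊥
    ^⊥-meet       : ∀ a → IsMeet _≤_ a (a ^⊥) 0#
    ^⊥-join       : ∀ a → IsJoin _≤_ a (a ^⊥) 1#

record SasakiOrthoposet (c ℓ₁ ℓ₂ : Level) : Set (suc (c ⊔ ℓ₁ ⊔ ℓ₂)) where
  infixl 7 _&_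
  infixl 7 _∧&_
  field
    boundedOrthoposet : BoundedOrthoposet c ℓ₁ ℓ₂

  open BoundedOrthoposet boundedOrthoposet public

  field
    _&_             : Op₂ Carrier
    -- Equality is the poset's _≈_, so being a function on P has to be required
    -- of _&_; for _^⊥ it follows from antitonicity and antisymmetry.
    &-cong          : Congruent₂ _≈_ _&_
    l-monotony      : ∀ a b c → a ≤ b → (a & c) ≤ (b & c)
    r-reduction     : ∀ a b → (a & b) ≤ b
    orthomodularity : ∀ a b → a ≤ b → a ≈ (a & b)
    galois          : ∀ a b c → (a & b) ≤ c → ((c ^⊥) & b) ≤ (a ^⊥)

  _∧&_ : Op₂ Carrier
  a ∧& b = ((a ^⊥) & b) ^⊥ & b

{-# OPTIONS --safe #-}
-- x ↦ x & b is linked to itself by a ⊥-twisted Galois connection and fixes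
-- everything below b.  This makes a ∧& b the meet of a and b, so the claim says
-- that a & b is the Sasaki projection b ∧ (b ∧ a⊥)⊥; both inequalities come
-- from the same Galois connection.
module Submission where

open import Defs
open import Level using (Level)
open import Data.Product.Base using (_,_)

module SasakiProperties {c ℓ₁ ℓ₂ : Level} (S : SasakiOrthoposet c ℓ₁ ℓ₂) where
  open SasakiOrthoposet S

  x⊥⊥≤x : ∀ x → x ^⊥ ^⊥ ≤ x
  x⊥⊥≤x x = reflexive (^⊥-involutive x)

  x≤x⊥⊥ : ∀ x → x ≤ x ^⊥ ^⊥
  x≤x⊥⊥ x = reflexive (Eq.sym (^⊥-involutive x))

  ^⊥-swapʳ : ∀ {x y} → x ≤ y ^⊥ → y ≤ x ^⊥
  ^⊥-swapʳ x≤y⊥ = trans (x≤x⊥⊥ _) (^⊥-antitone x≤y⊥)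

  -- Reading `u ≤ v ^⊥` as orthogonality, this is self-adjointness of `_& b`.
  galoisʳ : ∀ {x y b} → x & b ≤ y ^⊥ → y & b ≤ x ^⊥
  galoisʳ {x} {y} {b} p = trans (l-monotony _ _ b (x≤x⊥⊥ y)) (galois x b (y ^⊥) p)

  galoisˡ : ∀ {x y b} → x ^⊥ & b ≤ y → y ^⊥ & b ≤ x
  galoisˡ {x} {y} {b} p = trans (galois (x ^⊥) b y p) (x⊥⊥≤x x)

  x&b≤x : ∀ {x b} → x ≤ b → x & b ≤ x
  x&b≤x x≤b = reflexive (Eq.sym (orthomodularity _ _ x≤b))

  x≤x&b : ∀ {x b} → x ≤ b → x ≤ x & b
  x≤x&b x≤b = reflexive (orthomodularity _ _ x≤b)

  ∧&-lowerˡ : ∀ a b → a ∧& b ≤ a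
  ∧&-lowerˡ a b = galoisˡ refl

  ∧&-lowerʳ : ∀ a b → a ∧& b ≤ b
  ∧&-lowerʳ a b = r-reduction _ b

  -- Below `b` the map `_& b` is the identity, so monotony leaves only `x ≤ (a ^⊥ & b) ^⊥`, which
  -- Galois extracts from `x & b ≤ a`.
  ∧&-greatest : ∀ a b x → x ≤ a → x ≤ b → x ≤ a ∧& b
  ∧&-greatest a b x x≤a x≤b = trans (x≤x&b x≤b) (l-monotony _ _ b x≤[a⊥&b]⊥)
    where
    x≤[a⊥&b]⊥ : x ≤ (a ^⊥ & b) ^⊥
    x≤[a⊥&b]⊥ = ^⊥-swapʳ (galois x b a (trans (x&b≤x x≤b) x≤a))

  ∧&-isMeet : ∀ a b → IsMeet _≤_ a b (a ∧& b)
  ∧&-isMeet a b = ∧&-lowerˡ a b , ∧&-lowerʳ a b , ∧&-greatest a b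

  isMeet-unique : ∀ {x y m n} → IsMeet _≤_ x y m → IsMeet _≤_ x y n → m ≈ n
  isMeet-unique (m≤x , m≤y , m-greatest) (n≤x , n≤y , n-greatest) =
    antisym (n-greatest _ m≤x m≤y) (m-greatest _ n≤x n≤y)

  -- `m` may be any meet: the argument uses only its universal property.
  &-isMeet : ∀ {a b m} → IsMeet _≤_ b (a ^⊥) m → IsMeet _≤_ b (m ^⊥) (a & b)
  &-isMeet {a} {b} {m} (m≤b , m≤a⊥ , m-greatest) =
    r-reduction a b , galoisʳ (trans (x&b≤x m≤b) m≤a⊥) , greatest
    where
    [a&b]⊥&b≤m : (a & b) ^⊥ & b ≤ m
    -- Galois turns `a & b ≤ a & b` into the bound by `a ^⊥`.
    [a&b]⊥&b≤m = m-greatest _ (r-reduction _ b) (galois a b (a & b) refl)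

    greatest : ∀ y → y ≤ b → y ≤ m ^⊥ → y ≤ a & b
    greatest y y≤b y≤m⊥ =
      -- As `_& b` fixes `y`, it suffices to flip `(a & b) ^⊥ & b ≤ m ≤ y ^⊥` by Galois.
      trans (x≤x&b y≤b)
        (trans (galoisʳ (trans [a&b]⊥&b≤m (^⊥-swapʳ y≤m⊥))) (x⊥⊥≤x (a & b)))

proposition6 : {c ℓ₁ ℓ₂ : Level} (S : SasakiOrthoposet c ℓ₁ ℓ₂) →
    let open SasakiOrthoposet S in
    ∀ (a b : Carrier) → (a & b) ≈ (b ∧& ((b ∧& (a ^⊥)) ^⊥))
proposition6 S a b =
  isMeet-unique (&-isMeet (∧&-isMeet b (a ^⊥))) (∧&-isMeet b ((b ∧& (a ^⊥)) ^⊥))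
  where
  open SasakiOrthoposet S
  open SasakiProperties S
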